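{- For all $L\in\mathbf N$, $$\sum_{k=0}^L (-q)_{L-k}\,q^{(L+1)k}\begin{bmatrix} L\\ k\end{bmatrix}_q=\sum_{j=-\infty}^\infty (-1)^j q^{3j^2+j}\begin{bmatrix} 2L+1\\ L-3j\end{bmatrix}_q .$$
   Context: $\mathbf N$ denotes the set of nonnegative integers. For $m\in\mathbf N$, $(a)_m=(a;q)_m=\prod_{j=0}^{m-1}(1-aq^j)$, so $(q)_m=\prod_{j=1}^m(1-q^j)$ and $(-q)_m=\prod_{j=1}^m(1+q^j)$, with $(a)_0=1$. The $q$-binomial coefficient is $\begin{bmatrix} m+n\\ m\end{bmatrix}_q=\frac{(q)_{m+n}}{(q)_m(q)_n}$ if $m,n\in\mathbf N$, and it is $0$ otherwise (so $\begin{bmatrix} A\\ B\end{bmatrix}_q=0$ unless $0\le B\le A$). -}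

module Defs where

open import Algebra.Bundles using (CommutativeRing)
open import Data.Fin.Base using (toℕ)
open import Data.Integer.Base as ℤ using (ℤ; +_; ∣_∣)
open import Data.Nat.Base as ℕ using (ℕ; zero; suc)
open import Data.Product.Base using (∃-syntax; _×_; _,_; proj₁)
import Algebra.Definitions as Definitions
import Algebra.Properties.Semiring.Exp as Exp
import Algebra.Properties.Semiring.Sum as Sum
import Relation.Binary.Reasoning.Setoid as SetoidReasoning

module RingNotation {c ℓ} (R : CommutativeRing c ℓ) where

  open CommutativeRing R
  open Exp semiring public using (_^_)
  open Sum semiring public using (sum)

  IsUnit : Carrier → Set _
  IsUnit = Definitions.Invertible _≈_ 1# _*_

  1-unit : IsUnit 1#
  1-unit = 1# , *-identityˡ 1# , *-identityˡ 1#

  *-unit : ∀ {x y} → IsUnit x → IsUnit y → IsUnit (x * y)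
  *-unit {x} {y} (x⁻¹ , x⁻¹x≈1 , xx⁻¹≈1) (y⁻¹ , y⁻¹y≈1 , yy⁻¹≈1) =
    x⁻¹ * y⁻¹ , exchange x⁻¹x≈1 y⁻¹y≈1 , exchange xx⁻¹≈1 yy⁻¹≈1
    where
    open SetoidReasoning setoid
    exchange : ∀ {a b s t} → a * s ≈ 1# → b * t ≈ 1# → (a * b) * (s * t) ≈ 1#
    exchange {a} {b} {s} {t} as≈1 bt≈1 = begin
      (a * b) * (s * t)  ≈⟨ *-assoc a b (s * t) ⟩
      a * (b * (s * t))  ≈⟨ *-congˡ (*-assoc b s t) ⟨
      a * ((b * s) * t)  ≈⟨ *-congˡ (*-congʳ (*-comm b s)) ⟩
      a * ((s * b) * t)  ≈⟨ *-congˡ (*-assoc s b t) ⟩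
      a * (s * (b * t))  ≈⟨ *-assoc a s (b * t) ⟨
      (a * s) * (b * t)  ≈⟨ *-cong as≈1 bt≈1 ⟩
      1# * 1#            ≈⟨ *-identityˡ 1# ⟩
      1#                 ∎

  divide : ∀ (x : Carrier) {y} → IsUnit y → Carrier
  divide x y-unit = x * proj₁ y-unit

  -- The upper limit is included.
  ∑₀≤ : ℕ → (ℕ → Carrier) → Carrier
  ∑₀≤ n f = sum {suc n} (λ i → f (toℕ i))

  -- f (- N) + ⋯ + f N
  ∑± : ℕ → (ℤ → Carrier) → Carrier
  ∑± N f = ∑₀≤ (2 ℕ.* N) (λ i → f (+ i ℤ.- + N))

  -- s is the sum over all integers of the finitely supported family f.
  _IsSumOverℤ_ : Carrier → (ℤ → Carrier) → Set ℓ
  s IsSumOverℤ f =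
    ∃[ N ] (∀ j → N ℕ.< ∣ j ∣ → f j ≈ 0#) × s ≈ ∑± N f

  -- pochhammer a q m is (a ; q)ₘ, the product of 1 - a qʲ over 0 ≤ j < m.
  pochhammer : Carrier → Carrier → ℕ → Carrier
  pochhammer a q zero    = 1#
  pochhammer a q (suc m) = pochhammer a q m * (1# - a * q ^ m)

  -- The q-binomial coefficient is a quotient, so the factors 1 - qⁿ (n ≥ 1) of
  -- its denominator have to be invertible. This holds for an indeterminate q (in
  -- ℤ[[q]] or ℚ(q)), and for q in a field with qⁿ ≠ 1 for all n ≥ 1, in
  -- particular for complex q with |q| < 1.
  module QBinomial (q : Carrier) (1-qⁿ-unit : ∀ n → IsUnit (1# - q ^ suc n)) where

    [q]-unit : ∀ m → IsUnit (pochhammer q q m)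
    [q]-unit zero    = 1-unit
    [q]-unit (suc m) = *-unit ([q]-unit m) (1-qⁿ-unit m)

    -- The q-binomial coefficient with top m + n and bottom m.
    qBinomialSum : ℤ → ℤ → Carrier
    qBinomialSum (+ m) (+ n) =
      divide (pochhammer q q (m ℕ.+ n)) (*-unit ([q]-unit m) ([q]-unit n))
    qBinomialSum _     _     = 0#

    -- Top A, bottom B.
    qBinomial : ℤ → ℤ → Carrier
    qBinomial A B = qBinomialSum B (A ℤ.- B)

{-# OPTIONS --safe #-}

-- Write Q a b for the q-binomial coefficient with top a + b and bottom a, and put
--   T ε a b = ∑ⱼ (- 1)ʲ q^(ε j) Q (a - 3j) (b + 3j),  e j = 3j² + j,  d j = 3j² - 2j.
-- The right-hand side is S_L = T e L (L+1), with companion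
-- W_L = T d (L+1) L + T (d ∘ suc) (L-1) (L+2). The two q-Pascal rules and the
-- shift j ↦ j + 1 give, with x = q^(L+1),
--   S_{L+1} = S_L + x W_L + x² S_L,  W_{L+1} = x (2 S_L + x W_L).
-- On the left, let P_L(z) = ∑ₖ (- q)_{L-k} [L k] zᵏ, and A_L = P_L(x), the
-- left-hand side, and B_L = P_L(q x). From
--   P_{L+1}(z) = (z + x) P_L(z) + P_L(q z),
--   P_{L+1}(q z) = P_{L+1}(z) - z (1 - x) P_L(z)
-- one gets A_{L+1} = B_L + x (1 + x) A_L and B_{L+1} = A_{L+1} - q x (1 - x) B_L,
-- so A_L = S_L and B_L = (1 - x) S_L + x W_L by induction on L.
module Submission where

open import Defs
open import Algebra.Bundles using (CommutativeRing)
open import Data.Integer.Base as ℤ using (ℤ; +_; -[1+_]; ∣_∣)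
open import Data.Nat.Base as ℕ using (ℕ; zero; suc; z≤n; s≤s)

import Algebra.Properties.Ring as RingProperties
import Algebra.Solver.Ring.NaturalCoefficients.Default as SemiringSolver
import Data.Integer.Properties as ℤ
import Data.Nat.Properties as ℕ
open import Data.Fin.Base using (toℕ)
open import Data.Fin.Properties using (toℕ≤pred[n]; toℕ-inject₁; toℕ-fromℕ)
open import Data.Integer.Tactic.RingSolver using (solve-∀)
open import Data.Product.Base using (_×_; _,_; proj₁; proj₂)
open import Function.Base using (_∘_)
open import Relation.Binary.PropositionalEquality as ≡ using (_≡_; _≢_)
import Relation.Binary.Reasoning.Setoid as SetoidReasoning
open import Relation.Nullary.Negation using (contradiction)

-- Quadratic exponents

-- A product of two natural numbers is nonnegative, so `∣_∣` loses nothing on it. This identifies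
-- the natural exponents `e` and `d` with their polynomials.
+∣∣-product : ∀ x y {i} → i ≡ + x ℤ.* + y → + ∣ i ∣ ≡ i
+∣∣-product x y i≡xy rewrite i≡xy | ≡.sym (ℤ.pos-* x y) = ≡.refl

e d : ℤ → ℕ
e j = ∣ + 3 ℤ.* j ℤ.* j ℤ.+ j ∣
d j = ∣ + 3 ℤ.* j ℤ.* j ℤ.- + 2 ℤ.* j ∣

-- Passing j and x to factor by equations keeps Agda from normalising both
-- polynomials to compare them, which is slow.
+e : ∀ j → + e j ≡ + 3 ℤ.* j ℤ.* j ℤ.+ j
+e (+ n) = +∣∣-product n (suc (n ℕ.+ (n ℕ.+ n))) (factor (+ n) ≡.refl)
  where
  factor : ∀ i {x} → x ≡ + 1 ℤ.+ (i ℤ.+ (i ℤ.+ i)) → + 3 ℤ.* i ℤ.* i ℤ.+ i ≡ i ℤ.* x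
  factor i ≡.refl = identity i
    where
    identity : ∀ i → + 3 ℤ.* i ℤ.* i ℤ.+ i ≡ i ℤ.* (+ 1 ℤ.+ (i ℤ.+ (i ℤ.+ i)))
    identity = solve-∀
+e -[1+ n ] = +∣∣-product (suc n) (n ℕ.+ (suc n ℕ.+ suc n)) (factor (+ suc n) ≡.refl ≡.refl)
  where
  factor : ∀ i {j x} → j ≡ ℤ.- i → x ≡ (i ℤ.+ (i ℤ.+ i)) ℤ.- + 1 → + 3 ℤ.* j ℤ.* j ℤ.+ j ≡ i ℤ.* x
  factor i ≡.refl ≡.refl = identity i
    where
    identity : ∀ i → + 3 ℤ.* (ℤ.- i) ℤ.* (ℤ.- i) ℤ.+ (ℤ.- i) ≡ i ℤ.* ((i ℤ.+ (i ℤ.+ i)) ℤ.- + 1)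
    identity = solve-∀

-- The factorisation is `j (3j - 2)`. The case `j = 0` stands alone because its second factor would
-- be negative; for `j = - i` both signs flip, giving `i (3i + 2)`.
+d : ∀ j → + d j ≡ + 3 ℤ.* j ℤ.* j ℤ.- + 2 ℤ.* j
+d (+ zero)  = ≡.refl
+d (+ suc n) = +∣∣-product (suc n) (suc (n ℕ.+ (n ℕ.+ n))) (factor (+ n) ≡.refl ≡.refl)
  where
  factor : ∀ i {j x} → j ≡ + 1 ℤ.+ i → x ≡ + 1 ℤ.+ (i ℤ.+ (i ℤ.+ i)) →
           + 3 ℤ.* j ℤ.* j ℤ.- + 2 ℤ.* j ≡ j ℤ.* x
  factor i ≡.refl ≡.refl = identity i
    where
    identity : ∀ i → + 3 ℤ.* (+ 1 ℤ.+ i) ℤ.* (+ 1 ℤ.+ i) ℤ.- + 2 ℤ.* (+ 1 ℤ.+ i)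
                     ≡ (+ 1 ℤ.+ i) ℤ.* (+ 1 ℤ.+ (i ℤ.+ (i ℤ.+ i)))
    identity = solve-∀
+d -[1+ n ] = +∣∣-product (suc n) (2 ℕ.+ 3 ℕ.* suc n) (factor (+ suc n) ≡.refl ≡.refl)
  where
  factor : ∀ i {j x} → j ≡ ℤ.- i → x ≡ + 2 ℤ.+ (i ℤ.+ (i ℤ.+ (i ℤ.+ + 0))) →
           + 3 ℤ.* j ℤ.* j ℤ.- + 2 ℤ.* j ≡ i ℤ.* x
  factor i ≡.refl ≡.refl = identity i
    where
    identity : ∀ i → + 3 ℤ.* (ℤ.- i) ℤ.* (ℤ.- i) ℤ.- + 2 ℤ.* (ℤ.- i) ≡ i ℤ.* (+ 2 ℤ.+ (i ℤ.+ (i ℤ.+ (i ℤ.+ + 0))))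
    identity = solve-∀

-- Carries an identity between polynomials in `j` back to the natural numbers `e j` and `d j` that
-- represent them.
substitute-exponents : ∀ x y m a {i j} → + x ≡ i → + y ≡ j → i ℤ.+ a ≡ + m ℤ.+ j → + x ℤ.+ a ≡ + m ℤ.+ + y
substitute-exponents x y m a ≡.refl ≡.refl i+a≡m+j = i+a≡m+j

-- The chain is `a ≤ 3M + 2 < 3 (M + 1) ≤ 3n`; `3M + 2` is the largest bound for which it works.
a-3n<0 : ∀ {a} M n → a ℤ.≤ + (2 ℕ.+ 3 ℕ.* M) → M ℕ.< n → a ℤ.- + 3 ℤ.* + n ℤ.< + 0
a-3n<0 {a} M n a≤ M<n =
  ≡.subst (a ℤ.- + 3 ℤ.* + n ℤ.<_) (ℤ.+-inverseʳ (+ 3 ℤ.* + n)) (ℤ.+-monoˡ-< (ℤ.- (+ 3 ℤ.* + n)) a<3n)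
  where
  open ℕ.≤-Reasoning
  3M+2<3n : 2 ℕ.+ 3 ℕ.* M ℕ.< 3 ℕ.* n
  3M+2<3n = begin
    3 ℕ.+ 3 ℕ.* M  ≡⟨ ℕ.*-suc 3 M ⟨
    3 ℕ.* suc M    ≤⟨ ℕ.*-monoʳ-≤ 3 M<n ⟩
    3 ℕ.* n        ∎
  a<3n : a ℤ.< + 3 ℤ.* + n
  a<3n = ≡.subst (a ℤ.<_) (ℤ.pos-* 3 n) (ℤ.≤-<-trans a≤ (ℤ.+<+ 3M+2<3n))

-- Finite sums over initial segments of ℕ and symmetric ranges of ℤ

module Sums {c ℓ} (R : CommutativeRing c ℓ) where
  open CommutativeRing R
  open RingNotation R
  open SetoidReasoning setoid
  open import Algebra.Properties.Semiring.Sum semiring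

  ∑₀≤-cong : ∀ n {f g} → (∀ k → k ℕ.≤ n → f k ≈ g k) → ∑₀≤ n f ≈ ∑₀≤ n g
  ∑₀≤-cong n f≈g = sum-cong-≋ {suc n} (λ i → f≈g (toℕ i) (toℕ≤pred[n] i))

  ∑₀≤-+ : ∀ n f g → ∑₀≤ n (λ k → f k + g k) ≈ ∑₀≤ n f + ∑₀≤ n g
  ∑₀≤-+ n f g = ∑-distrib-+ {suc n} (f ∘ toℕ) (g ∘ toℕ)

  ∑₀≤-*ˡ : ∀ n x f → ∑₀≤ n (λ k → x * f k) ≈ x * ∑₀≤ n f
  ∑₀≤-*ˡ n x f = sym (*-distribˡ-sum {suc n} x (f ∘ toℕ))

  ∑₀≤-last : ∀ n f → ∑₀≤ (suc n) f ≈ ∑₀≤ n f + f (suc n)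
  ∑₀≤-last n f = trans (sum-init-last {suc n} (f ∘ toℕ))
    (+-cong (sum-cong-≋ {suc n} (λ i → reflexive (≡.cong f (toℕ-inject₁ i))))
            (reflexive (≡.cong f (toℕ-fromℕ (suc n)))))

  ∑₀≤-zero : ∀ n {f} → (∀ k → f k ≈ 0#) → ∑₀≤ n f ≈ 0#
  ∑₀≤-zero n f≈0 = trans (sum-cong-≋ {suc n} (λ i → f≈0 (toℕ i))) (sum-replicate-zero (suc n))

  ∑₀≤-single : ∀ n f {k} → k ℕ.≤ n → (∀ i → i ≢ k → f i ≈ 0#) → ∑₀≤ n f ≈ f k
  ∑₀≤-single zero    f {zero}  _         f≈0 = +-identityʳ (f 0)
  ∑₀≤-single (suc n) f {zero}  _         f≈0 =
    trans (+-congˡ (∑₀≤-zero n (λ i → f≈0 (suc i) λ ()))) (+-identityʳ (f 0))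
  ∑₀≤-single (suc n) f {suc k} (s≤s k≤n) f≈0 = trans
    (+-cong (f≈0 0 λ ()) (∑₀≤-single n (f ∘ suc) k≤n (λ i i≢k → f≈0 (suc i) (i≢k ∘ ℕ.suc-injective))))
    (+-identityˡ (f (suc k)))

  ∑±-cong : ∀ N {f g} → (∀ j → f j ≈ g j) → ∑± N f ≈ ∑± N g
  ∑±-cong N f≈g = ∑₀≤-cong (2 ℕ.* N) (λ i _ → f≈g (+ i ℤ.- + N))

  ∑±-+ : ∀ N f g → ∑± N (λ j → f j + g j) ≈ ∑± N f + ∑± N g
  ∑±-+ N f g = ∑₀≤-+ (2 ℕ.* N) (λ i → f (+ i ℤ.- + N)) (λ i → g (+ i ℤ.- + N))

  ∑±-*ˡ : ∀ N x f → ∑± N (λ j → x * f j) ≈ x * ∑± N f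
  ∑±-*ˡ N x f = ∑₀≤-*ˡ (2 ℕ.* N) x (λ i → f (+ i ℤ.- + N))

  ∑±-single : ∀ N f → (∀ j → j ≢ + 0 → f j ≈ 0#) → ∑± N f ≈ f (+ 0)
  ∑±-single N f f≈0 = trans
    (∑₀≤-single (2 ℕ.* N) (λ i → f (+ i ℤ.- + N)) (ℕ.m≤m+n N (N ℕ.+ 0))
      (λ i i≢N → f≈0 (+ i ℤ.- + N) (i≢N ∘ ℤ.+-injective ∘ ℤ.i-j≡0⇒i≡j (+ i) (+ N))))
    (reflexive (≡.cong f (ℤ.+-inverseʳ (+ N))))

  -- Both sides are parts of the sum over `- N ≤ j ≤ N + 1`: the shifted one omits `j = - N`, the
  -- other omits `j = N + 1`, and both omitted terms are zero.
  ∑±-shift : ∀ N f → f (ℤ.- + N) ≈ 0# → f (+ suc N) ≈ 0# → ∑± N (f ∘ ℤ.suc) ≈ ∑± N f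
  ∑±-shift N f first≈0 last≈0 = begin
    ∑± N (f ∘ ℤ.suc)             ≈⟨ +-identityˡ _ ⟨
    0# + ∑± N (f ∘ ℤ.suc)        ≈⟨ +-cong (trans (reflexive (≡.cong f first)) first≈0) (∑₀≤-cong (2 ℕ.* N) (λ i _ → reflexive (≡.cong f (middle i)))) ⟨
    ∑₀≤ (suc (2 ℕ.* N)) g        ≈⟨ ∑₀≤-last (2 ℕ.* N) g ⟩
    ∑± N f + g (suc (2 ℕ.* N))   ≈⟨ +-congˡ (trans (reflexive (≡.cong f last)) last≈0) ⟩
    ∑± N f + 0#                  ≈⟨ +-identityʳ _ ⟩
    ∑± N f                       ∎
    where
    g : ℕ → Carrier
    g i = f (+ i ℤ.- + N)
    first : + 0 ℤ.- + N ≡ ℤ.- + N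
    first = ℤ.+-identityˡ (ℤ.- + N)
    middle : ∀ i → + suc i ℤ.- + N ≡ ℤ.suc (+ i ℤ.- + N)
    middle i = ℤ.+-assoc (+ 1) (+ i) (ℤ.- + N)
    last : + suc (2 ℕ.* N) ℤ.- + N ≡ + suc N
    last = identity (+ N)
      where
      identity : ∀ n → (+ 1 ℤ.+ (n ℤ.+ (n ℤ.+ + 0))) ℤ.- n ≡ + 1 ℤ.+ n
      identity = solve-∀

module QBinomialSums {c ℓ} (R : CommutativeRing c ℓ) where
  open CommutativeRing R
  open RingNotation R
  open Sums R
  open SetoidReasoning setoid
  open RingProperties ring using (-1*x≈-x; -‿distribˡ-*; -‿distribʳ-*)
  open import Algebra.Properties.Semiring.Exp semiring using (^-homo-*; ^-assocʳ)
  open import Algebra.Properties.CommutativeSemiring.Exp commutativeSemiring using (^-distrib-*)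
  open SemiringSolver commutativeSemiring using (solve; con; _:=_; _:+_; _:*_)

  module _ (q : Carrier) (1-qⁿ-unit : ∀ n → IsUnit (1# - q ^ suc n)) where
    open QBinomial q 1-qⁿ-unit

    -- q-Pascal rules

    Q : ℤ → ℤ → Carrier
    Q = qBinomialSum

    Q-comm : ∀ a b → Q a b ≈ Q b a
    Q-comm (+ m)    (+ n)    = *-cong (reflexive (≡.cong (pochhammer q q) (ℕ.+-comm m n))) (*-comm _ _)
    Q-comm (+ m)    -[1+ n ] = refl
    Q-comm -[1+ m ] (+ n)    = refl
    Q-comm -[1+ m ] -[1+ n ] = refl

    Q-negˡ : ∀ {a b} → a ℤ.< + 0 → Q a b ≈ 0#
    Q-negˡ ℤ.-<+ = refl

    Q-negʳ : ∀ {a b} → b ℤ.< + 0 → Q a b ≈ 0#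
    Q-negʳ {+ m}    ℤ.-<+ = refl
    Q-negʳ { -[1+ m ]} ℤ.-<+ = refl

    pochhammer-unit : ∀ m → pochhammer q q m * proj₁ ([q]-unit m) ≈ 1#
    pochhammer-unit m = proj₂ (proj₂ ([q]-unit m))

    Q-0ˡ : ∀ n → Q (+ 0) (+ n) ≈ 1#
    Q-0ˡ n = trans (*-congˡ (*-identityˡ _)) (pochhammer-unit n)

    -- With `x = q ^ suc m` and `y = q ^ suc n` this splits the last factor of the numerator: it is
    -- the q-Pascal rule before division by the denominator.
    1-xy : ∀ x y → 1# - x * y ≈ (1# - x) + x * (1# - y)
    1-xy x y = sym (begin
      (1# - x) + x * (1# - y)          ≈⟨ +-congˡ (distribˡ x 1# (- y)) ⟩
      (1# - x) + (x * 1# + x * - y)    ≈⟨ +-congˡ (+-cong (*-identityʳ x) (sym (-‿distribʳ-* x y))) ⟩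
      (1# - x) + (x - x * y)           ≈⟨ solve 4 (λ u x′ x z → (u :+ x′) :+ (x :+ z) := u :+ ((x′ :+ x) :+ z)) refl 1# (- x) x (- (x * y)) ⟩
      1# + ((- x + x) - x * y)         ≈⟨ +-congˡ (trans (+-congʳ (-‿inverseˡ x)) (+-identityˡ _)) ⟩
      1# - x * y                       ∎)

    unit-suc : ∀ m → proj₁ ([q]-unit (suc m)) * (1# - q ^ suc m) ≈ proj₁ ([q]-unit m)
    unit-suc m = begin
      (u * v) * t  ≈⟨ *-assoc u v t ⟩
      u * (v * t)  ≈⟨ *-congˡ (proj₁ (proj₂ (1-qⁿ-unit m))) ⟩
      u * 1#       ≈⟨ *-identityʳ u ⟩
      u            ∎
      where
      u = proj₁ ([q]-unit m)
      v = proj₁ (1-qⁿ-unit m)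
      t = 1# - q ^ suc m

    Q-pascal-suc : ∀ m n →
      Q (+ suc m) (+ suc n) ≈ Q (+ m) (+ suc n) + q ^ suc m * Q (+ suc m) (+ n)
    Q-pascal-suc m n = begin
      p * (1# - q ^ (suc m ℕ.+ suc n)) * (um′ * un′)
        ≈⟨ *-congʳ (*-congˡ (trans (+-congˡ (-‿cong (^-homo-* q (suc m) (suc n)))) (1-xy _ _))) ⟩
      p * (tm + x * tn) * (um′ * un′)
        ≈⟨ solve 6 (λ p tm tn x u v → p :* (tm :+ x :* tn) :* (u :* v)
             := p :* ((u :* tm) :* v) :+ x :* (p :* (u :* (v :* tn)))) refl p tm tn x um′ un′ ⟩
      p * ((um′ * tm) * un′) + x * (p * (um′ * (un′ * tn)))
        ≈⟨ +-cong (*-congˡ (*-congʳ (unit-suc m)))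
                  (*-congˡ (*-cong (reflexive (≡.cong (pochhammer q q) (ℕ.+-suc m n))) (*-congˡ (unit-suc n)))) ⟩
      Q (+ m) (+ suc n) + x * Q (+ suc m) (+ n) ∎
      where
      p   = pochhammer q q (m ℕ.+ suc n)
      x   = q ^ suc m
      tm  = 1# - q ^ suc m
      tn  = 1# - q ^ suc n
      um′ = proj₁ ([q]-unit (suc m))
      un′ = proj₁ ([q]-unit (suc n))

    -- The rule breaks down at `a = b = 0`, where the left side is 1 and both terms on the right are
    -- 0. The condition is put on `a + b` because the sums below move along lines on which `a + b`
    -- is constant.
    Q-pascalˡ : ∀ a b → a ℤ.+ b ≢ + 0 →
                Q a b ≈ Q (ℤ.pred a) b + q ^ ∣ a ∣ * Q a (ℤ.pred b)
    Q-pascalˡ (+ zero)  (+ zero)  a+b≢0 = contradiction ≡.refl a+b≢0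
    Q-pascalˡ (+ zero)  (+ suc n) _ = begin
      Q (+ 0) (+ suc n)         ≈⟨ trans (Q-0ˡ (suc n)) (sym (Q-0ˡ n)) ⟩
      Q (+ 0) (+ n)             ≈⟨ trans (+-identityˡ _) (*-identityˡ _) ⟨
      0# + 1# * Q (+ 0) (+ n)   ∎
    Q-pascalˡ (+ suc m) (+ zero)  _ = begin
      Q (+ suc m) (+ 0)                ≈⟨ trans (Q-comm (+ suc m) (+ 0)) (trans (Q-0ˡ (suc m)) (sym (trans (Q-comm (+ m) (+ 0)) (Q-0ˡ m)))) ⟩
      Q (+ m) (+ 0)                    ≈⟨ trans (+-congˡ (zeroʳ _)) (+-identityʳ _) ⟨
      Q (+ m) (+ 0) + q ^ suc m * 0#   ∎
    Q-pascalˡ (+ suc m) (+ suc n) _ = Q-pascal-suc m n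
    Q-pascalˡ (+ zero)  -[1+ n ]  _ = sym (trans (+-identityˡ _) (zeroʳ _))
    Q-pascalˡ (+ suc m) -[1+ n ]  _ = sym (trans (+-identityˡ _) (zeroʳ _))
    Q-pascalˡ -[1+ m ]  b         _ = sym (trans (+-identityˡ _) (zeroʳ _))

    Q-pascalʳ : ∀ a b → a ℤ.+ b ≢ + 0 →
                Q a b ≈ Q a (ℤ.pred b) + q ^ ∣ b ∣ * Q (ℤ.pred a) b
    Q-pascalʳ a b a+b≢0 = begin
      Q a b                                        ≈⟨ Q-comm a b ⟩
      Q b a                                        ≈⟨ Q-pascalˡ b a (a+b≢0 ∘ ≡.trans (ℤ.+-comm a b)) ⟩
      Q (ℤ.pred b) a + q ^ ∣ b ∣ * Q b (ℤ.pred a)  ≈⟨ +-cong (Q-comm (ℤ.pred b) a) (*-congˡ (Q-comm b (ℤ.pred a))) ⟩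
      Q a (ℤ.pred b) + q ^ ∣ b ∣ * Q (ℤ.pred a) b  ∎

    -- Alternating sums of q-binomial coefficients in steps of three

    sign-suc : ∀ j → (- 1#) ^ ∣ ℤ.suc j ∣ ≈ - (- 1#) ^ ∣ j ∣
    sign-suc (+ n)        = -1*x≈-x _
    sign-suc -[1+ zero ]  = sym (begin
      - (- 1# * 1#)  ≈⟨ -‿distribʳ-* (- 1#) 1# ⟩
      - 1# * - 1#    ≈⟨ -1*x≈-x (- 1#) ⟩
      - - 1#         ≈⟨ RingProperties.-‿involutive ring 1# ⟩
      1#             ∎)
    sign-suc -[1+ suc n ] = begin
      (- 1#) ^ suc n               ≈⟨ RingProperties.-‿involutive ring _ ⟨
      - - (- 1#) ^ suc n           ≈⟨ -‿cong (-1*x≈-x _) ⟨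
      - (- 1# * (- 1#) ^ suc n)    ∎

    term : (ℤ → ℕ) → ℤ → ℤ → ℤ → Carrier
    term ε a b j = (- 1#) ^ ∣ j ∣ * q ^ ε j * Q (a ℤ.- + 3 ℤ.* j) (b ℤ.+ + 3 ℤ.* j)

    term-vanishes : ∀ ε {a b} M j → a ℤ.≤ + (2 ℕ.+ 3 ℕ.* M) → b ℤ.≤ + (2 ℕ.+ 3 ℕ.* M) →
                    M ℕ.< ∣ j ∣ → term ε a b j ≈ 0#
    term-vanishes ε {a} {b} M (+ n) a≤ _ M<j = trans (*-congˡ (Q-negˡ {b = b ℤ.+ + 3 ℤ.* + n} (a-3n<0 M n a≤ M<j))) (zeroʳ _)
    term-vanishes ε {a} {b} M -[1+ n ] _ b≤ M<j = trans (*-congˡ (Q-negʳ {a = a ℤ.- + 3 ℤ.* -[1+ n ]}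
      (≡.subst (λ i → b ℤ.+ i ℤ.< + 0) (ℤ.neg-distribʳ-* (+ 3) (+ suc n)) (a-3n<0 M (suc n) b≤ M<j)))) (zeroʳ _)

    -- The window `N` is a parameter so that sums with different indices can share it. The Pascal
    -- steps hold term by term in any window; only `T-shift` needs one that is large enough.
    T : ℕ → (ℤ → ℕ) → ℤ → ℤ → Carrier
    T N ε a b = ∑± N (term ε a b)

    -- The exponent x + a is only required to be m + y in ℤ: for negative a, where
    -- ∣ a ∣ is wrong, the factor Q a b vanishes.
    move-exponentˡ : ∀ x m y a b → + x ℤ.+ a ≡ + m ℤ.+ + y →
                     q ^ x * (q ^ ∣ a ∣ * Q a b) ≈ q ^ m * (q ^ y * Q a b)
    move-exponentˡ x m y (+ n) b x+a≡m+y = begin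
      q ^ x * (q ^ n * Q (+ n) b)    ≈⟨ *-assoc _ _ _ ⟨
      q ^ x * q ^ n * Q (+ n) b      ≈⟨ *-congʳ (^-homo-* q x n) ⟨
      q ^ (x ℕ.+ n) * Q (+ n) b      ≈⟨ *-congʳ (reflexive (≡.cong (q ^_) (ℤ.+-injective x+a≡m+y))) ⟩
      q ^ (m ℕ.+ y) * Q (+ n) b      ≈⟨ *-congʳ (^-homo-* q m y) ⟩
      q ^ m * q ^ y * Q (+ n) b      ≈⟨ *-assoc _ _ _ ⟩
      q ^ m * (q ^ y * Q (+ n) b)    ∎
    move-exponentˡ _ _ _ -[1+ n ] b _ = trans (vanishes _ _) (sym (vanishes _ _))
      where
      vanishes : ∀ u v → u * (v * 0#) ≈ 0#
      vanishes u v = trans (*-congˡ (zeroʳ v)) (zeroʳ u)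

    move-exponentʳ : ∀ x m y a b → + x ℤ.+ b ≡ + m ℤ.+ + y →
                     q ^ x * (q ^ ∣ b ∣ * Q a b) ≈ q ^ m * (q ^ y * Q a b)
    move-exponentʳ x m y a b x+b≡m+y = begin
      _ ≈⟨ *-congˡ (*-congˡ (Q-comm a b)) ⟩
      _ ≈⟨ move-exponentˡ x m y b a x+b≡m+y ⟩
      _ ≈⟨ *-congˡ (*-congˡ (Q-comm b a)) ⟩
      _ ∎

    a+b-steps : ∀ a b j → (a ℤ.- + 3 ℤ.* j) ℤ.+ (b ℤ.+ + 3 ℤ.* j) ≡ a ℤ.+ b
    a+b-steps = solve-∀

    -- The Pascal factor `q ^ ∣ a - 3j ∣` changes the quadratic exponent `ε` into another one, `ε′`,
    -- up to a power `q ^ m` that does not depend on `j` and leaves the sum.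
    T-pascalˡ : ∀ N ε ε′ m a b → a ℤ.+ b ≢ + 0 →
      (∀ j → + ε j ℤ.+ (a ℤ.- + 3 ℤ.* j) ≡ + m ℤ.+ + ε′ j) →
      T N ε a b ≈ T N ε (ℤ.pred a) b + q ^ m * T N ε′ a (ℤ.pred b)
    T-pascalˡ N ε ε′ m a b a+b≢0 exponents = begin
      ∑± N (term ε a b)
        ≈⟨ ∑±-cong N {f = term ε a b} {g = λ j → term ε (ℤ.pred a) b j + q ^ m * term ε′ a (ℤ.pred b) j} pascal ⟩
      ∑± N (λ j → term ε (ℤ.pred a) b j + q ^ m * term ε′ a (ℤ.pred b) j)
        ≈⟨ ∑±-+ N (term ε (ℤ.pred a) b) (λ j → q ^ m * term ε′ a (ℤ.pred b) j) ⟩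
      T N ε (ℤ.pred a) b + ∑± N (λ j → q ^ m * term ε′ a (ℤ.pred b) j)
        ≈⟨ +-congˡ (∑±-*ˡ N (q ^ m) (term ε′ a (ℤ.pred b))) ⟩
      T N ε (ℤ.pred a) b + q ^ m * T N ε′ a (ℤ.pred b)  ∎
      where
      pascal : ∀ j → term ε a b j ≈ term ε (ℤ.pred a) b j + q ^ m * term ε′ a (ℤ.pred b) j
      pascal j = begin
        s * q ^ ε j * Q A B
          ≈⟨ *-congˡ (Q-pascalˡ A B (a+b≢0 ∘ ≡.trans (≡.sym (a+b-steps a b j)))) ⟩
        s * q ^ ε j * (Q (ℤ.pred A) B + q ^ ∣ A ∣ * Q A (ℤ.pred B))
          ≈⟨ solve 5 (λ s x q₁ y q₂ → s :* x :* (q₁ :+ y :* q₂) := s :* x :* q₁ :+ s :* (x :* (y :* q₂))) refl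
               s (q ^ ε j) (Q (ℤ.pred A) B) (q ^ ∣ A ∣) (Q A (ℤ.pred B)) ⟩
        s * q ^ ε j * Q (ℤ.pred A) B + s * (q ^ ε j * (q ^ ∣ A ∣ * Q A (ℤ.pred B)))
          ≈⟨ +-congˡ (*-congˡ (move-exponentˡ (ε j) m (ε′ j) A (ℤ.pred B) (exponents j))) ⟩
        s * q ^ ε j * Q (ℤ.pred A) B + s * (q ^ m * (q ^ ε′ j * Q A (ℤ.pred B)))
          ≈⟨ +-cong (*-congˡ (reflexive (≡.cong (λ i → Q i B) (≡.sym (ℤ.+-assoc (ℤ.- + 1) a (ℤ.- (+ 3 ℤ.* j)))))))
                    (trans (solve 4 (λ s x y q₂ → s :* (x :* (y :* q₂)) := x :* (s :* y :* q₂)) refl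
                             s (q ^ m) (q ^ ε′ j) (Q A (ℤ.pred B)))
                           (*-congˡ (*-congˡ (reflexive (≡.cong (Q A) (≡.sym (ℤ.+-assoc (ℤ.- + 1) b (+ 3 ℤ.* j)))))))) ⟩
        term ε (ℤ.pred a) b j + q ^ m * term ε′ a (ℤ.pred b) j ∎
        where
        s = (- 1#) ^ ∣ j ∣
        A = a ℤ.- + 3 ℤ.* j
        B = b ℤ.+ + 3 ℤ.* j

    T-pascalʳ : ∀ N ε ε′ m a b → a ℤ.+ b ≢ + 0 →
      (∀ j → + ε j ℤ.+ (b ℤ.+ + 3 ℤ.* j) ≡ + m ℤ.+ + ε′ j) →
      T N ε a b ≈ T N ε a (ℤ.pred b) + q ^ m * T N ε′ (ℤ.pred a) b
    T-pascalʳ N ε ε′ m a b a+b≢0 exponents = begin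
      ∑± N (term ε a b)
        ≈⟨ ∑±-cong N {f = term ε a b} {g = λ j → term ε a (ℤ.pred b) j + q ^ m * term ε′ (ℤ.pred a) b j} pascal ⟩
      ∑± N (λ j → term ε a (ℤ.pred b) j + q ^ m * term ε′ (ℤ.pred a) b j)
        ≈⟨ ∑±-+ N (term ε a (ℤ.pred b)) (λ j → q ^ m * term ε′ (ℤ.pred a) b j) ⟩
      T N ε a (ℤ.pred b) + ∑± N (λ j → q ^ m * term ε′ (ℤ.pred a) b j)
        ≈⟨ +-congˡ (∑±-*ˡ N (q ^ m) (term ε′ (ℤ.pred a) b)) ⟩
      T N ε a (ℤ.pred b) + q ^ m * T N ε′ (ℤ.pred a) b  ∎
      where
      pascal : ∀ j → term ε a b j ≈ term ε a (ℤ.pred b) j + q ^ m * term ε′ (ℤ.pred a) b j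
      pascal j = begin
        s * q ^ ε j * Q A B
          ≈⟨ *-congˡ (Q-pascalʳ A B (a+b≢0 ∘ ≡.trans (≡.sym (a+b-steps a b j)))) ⟩
        s * q ^ ε j * (Q A (ℤ.pred B) + q ^ ∣ B ∣ * Q (ℤ.pred A) B)
          ≈⟨ solve 5 (λ s x q₁ y q₂ → s :* x :* (q₁ :+ y :* q₂) := s :* x :* q₁ :+ s :* (x :* (y :* q₂))) refl
               s (q ^ ε j) (Q A (ℤ.pred B)) (q ^ ∣ B ∣) (Q (ℤ.pred A) B) ⟩
        s * q ^ ε j * Q A (ℤ.pred B) + s * (q ^ ε j * (q ^ ∣ B ∣ * Q (ℤ.pred A) B))
          ≈⟨ +-congˡ (*-congˡ (move-exponentʳ (ε j) m (ε′ j) (ℤ.pred A) B (exponents j))) ⟩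
        s * q ^ ε j * Q A (ℤ.pred B) + s * (q ^ m * (q ^ ε′ j * Q (ℤ.pred A) B))
          ≈⟨ +-cong (*-congˡ (reflexive (≡.cong (Q A) (≡.sym (ℤ.+-assoc (ℤ.- + 1) b (+ 3 ℤ.* j))))))
                    (trans (solve 4 (λ s x y q₂ → s :* (x :* (y :* q₂)) := x :* (s :* y :* q₂)) refl
                             s (q ^ m) (q ^ ε′ j) (Q (ℤ.pred A) B))
                           (*-congˡ (*-congˡ (reflexive (≡.cong (λ i → Q i B) (≡.sym (ℤ.+-assoc (ℤ.- + 1) a (ℤ.- (+ 3 ℤ.* j))))))))) ⟩
        term ε a (ℤ.pred b) j + q ^ m * term ε′ (ℤ.pred a) b j ∎
        where
        s = (- 1#) ^ ∣ j ∣
        A = a ℤ.- + 3 ℤ.* j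
        B = b ℤ.+ + 3 ℤ.* j

    -- Replacing `j` by `j + 1` lowers the first index by 3, raises the second by 3 and flips the
    -- sign, so the second sum is the negative of the first. The bounds on `a` and `b` make the end
    -- terms at `- (M + 1)` and `M + 2` vanish.
    T-shift : ∀ M ε ε′ a b a′ b′ → a ℤ.≤ + (2 ℕ.+ 3 ℕ.* M) → b ℤ.≤ + (2 ℕ.+ 3 ℕ.* M) →
      (∀ j → ε′ j ≡ ε (ℤ.suc j)) → a ≡ a′ ℤ.+ + 3 → b′ ≡ b ℤ.+ + 3 →
      T (suc M) ε a b + T (suc M) ε′ a′ b′ ≈ 0#
    T-shift M ε ε′ _ b a′ _ a≤ b≤ ε′≡ ≡.refl ≡.refl = begin
      T N ε a b + T N ε′ a′ b′                     ≈⟨ +-congʳ (∑±-shift N (term ε a b) (term-vanishes ε M -[1+ M ] a≤ b≤ ℕ.≤-refl) (term-vanishes ε M (+ suc N) a≤ b≤ (ℕ.m≤n⇒m≤1+n ℕ.≤-refl))) ⟨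
      ∑± N (term ε a b ∘ ℤ.suc) + T N ε′ a′ b′     ≈⟨ ∑±-+ N (term ε a b ∘ ℤ.suc) (term ε′ a′ b′) ⟨
      ∑± N (λ j → term ε a b (ℤ.suc j) + term ε′ a′ b′ j)  ≈⟨ ∑±-cong N {f = λ j → term ε a b (ℤ.suc j) + term ε′ a′ b′ j} {g = λ _ → 0#} cancel ⟩
      ∑± N (λ j → 0#)                              ≈⟨ ∑₀≤-zero (2 ℕ.* N) (λ _ → refl) ⟩
      0#                                           ∎
      where
      N = suc M
      a = a′ ℤ.+ + 3
      b′ = b ℤ.+ + 3
      stepˡ : ∀ a j → (a ℤ.+ + 3) ℤ.- + 3 ℤ.* (+ 1 ℤ.+ j) ≡ a ℤ.- + 3 ℤ.* j
      stepˡ = solve-∀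
      stepʳ : ∀ b j → b ℤ.+ + 3 ℤ.* (+ 1 ℤ.+ j) ≡ (b ℤ.+ + 3) ℤ.+ + 3 ℤ.* j
      stepʳ = solve-∀
      cancel : ∀ j → term ε a b (ℤ.suc j) + term ε′ a′ b′ j ≈ 0#
      cancel j rewrite stepˡ a′ j | stepʳ b j | ε′≡ j = begin
        s′ * x * y + s * x * y  ≈⟨ +-congʳ (*-congʳ (*-congʳ (sign-suc j))) ⟩
        - s * x * y + s * x * y ≈⟨ solve 4 (λ s′ s x y → s′ :* x :* y :+ s :* x :* y := (s′ :+ s) :* x :* y) refl (- s) s x y ⟩
        (- s + s) * x * y       ≈⟨ *-congʳ (*-congʳ (-‿inverseˡ s)) ⟩
        0# * x * y              ≈⟨ trans (*-congʳ (zeroˡ x)) (zeroˡ y) ⟩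
        0#                      ∎
        where
        s′ = (- 1#) ^ ∣ ℤ.suc j ∣
        s = (- 1#) ^ ∣ j ∣
        x = q ^ ε (ℤ.suc j)
        y = Q (a′ ℤ.- + 3 ℤ.* j) ((b ℤ.+ + 3) ℤ.+ + 3 ℤ.* j)

    -- Recurrences for the right-hand side

    S U V W X Z : ℕ → ℕ → Carrier
    S N L = T N e (+ L) (+ suc L)
    U N L = T N (d ∘ ℤ.suc) (ℤ.pred (+ L)) (+ suc (suc L))
    V N L = T N d (+ suc L) (+ L)
    W N L = V N L + U N L
    X N L = T N e (+ suc L) (+ suc L)
    Z N L = T N e (+ L) (+ suc (suc L))

    -- This and the next three lemmas rest on `e j - 3j = d j`, `d j + 3j = e j`,
    -- `e j + 3j = d (j + 1) - 1` and `d j - 3j = e (j - 1) - 2`. The constants are offset by the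
    -- indices `L + 1`, `L + 2`, `L + 3`, so that the same power `q ^ suc L` comes out each time.
    e-3j : ∀ L j → + e j ℤ.+ (+ suc L ℤ.- + 3 ℤ.* j) ≡ + suc L ℤ.+ + d j
    e-3j L j = substitute-exponents (e j) (d j) (suc L) (+ suc L ℤ.- + 3 ℤ.* j) (+e j) (+d j) (identity (+ L) j)
      where
      identity : ∀ l j → (+ 3 ℤ.* j ℤ.* j ℤ.+ j) ℤ.+ ((+ 1 ℤ.+ l) ℤ.- + 3 ℤ.* j)
                         ≡ (+ 1 ℤ.+ l) ℤ.+ (+ 3 ℤ.* j ℤ.* j ℤ.- + 2 ℤ.* j)
      identity = solve-∀

    d+3j : ∀ L j → + d j ℤ.+ (+ suc L ℤ.+ + 3 ℤ.* j) ≡ + suc L ℤ.+ + e j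
    d+3j L j = substitute-exponents (d j) (e j) (suc L) (+ suc L ℤ.+ + 3 ℤ.* j) (+d j) (+e j) (identity (+ L) j)
      where
      identity : ∀ l j → (+ 3 ℤ.* j ℤ.* j ℤ.- + 2 ℤ.* j) ℤ.+ ((+ 1 ℤ.+ l) ℤ.+ + 3 ℤ.* j)
                         ≡ (+ 1 ℤ.+ l) ℤ.+ (+ 3 ℤ.* j ℤ.* j ℤ.+ j)
      identity = solve-∀

    e+3j : ∀ L j → + e j ℤ.+ (+ suc (suc L) ℤ.+ + 3 ℤ.* j) ≡ + suc L ℤ.+ + d (ℤ.suc j)
    e+3j L j = substitute-exponents (e j) (d (ℤ.suc j)) (suc L) (+ suc (suc L) ℤ.+ + 3 ℤ.* j) (+e j) (+d (ℤ.suc j)) (identity (+ L) j)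
      where
      identity : ∀ l j → (+ 3 ℤ.* j ℤ.* j ℤ.+ j) ℤ.+ ((+ 2 ℤ.+ l) ℤ.+ + 3 ℤ.* j)
                         ≡ (+ 1 ℤ.+ l) ℤ.+ (+ 3 ℤ.* (+ 1 ℤ.+ j) ℤ.* (+ 1 ℤ.+ j) ℤ.- + 2 ℤ.* (+ 1 ℤ.+ j))
      identity = solve-∀

    d-3j : ∀ L j → + d j ℤ.+ (+ suc (suc (suc L)) ℤ.- + 3 ℤ.* j) ≡ + suc L ℤ.+ + e (ℤ.pred j)
    d-3j L j = substitute-exponents (d j) (e (ℤ.pred j)) (suc L) (+ suc (suc (suc L)) ℤ.- + 3 ℤ.* j) (+d j) (+e (ℤ.pred j)) (identity (+ L) j)
      where
      identity : ∀ l j → (+ 3 ℤ.* j ℤ.* j ℤ.- + 2 ℤ.* j) ℤ.+ ((+ 3 ℤ.+ l) ℤ.- + 3 ℤ.* j)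
                         ≡ (+ 1 ℤ.+ l) ℤ.+ (+ 3 ℤ.* (ℤ.- + 1 ℤ.+ j) ℤ.* (ℤ.- + 1 ℤ.+ j) ℤ.+ (ℤ.- + 1 ℤ.+ j))
      identity = solve-∀

    L+suc≢0 : ∀ L n → + L ℤ.+ + suc n ≢ + 0
    L+suc≢0 L n eq = ℕ.1+n≢0 (≡.trans (≡.sym (ℕ.+-suc L n)) (ℤ.+-injective eq))

    Z≈ : ∀ N L → Z N L ≈ S N L + q ^ suc L * U N L
    Z≈ N L = T-pascalʳ N e (d ∘ ℤ.suc) (suc L) (+ L) (+ suc (suc L)) (L+suc≢0 L (suc L)) (e+3j L)

    -- `X` and `Z` have top `2L + 2`, halfway between levels `L` and `L + 1`. One Pascal step takes
    -- each of them to `S`, and the remaining terms are the two halves `V` and `U` of `W`.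
    X+Z : ∀ N L → X N L + Z N L ≈ (S N L + S N L) + q ^ suc L * W N L
    X+Z N L = begin
      X N L + Z N L
        ≈⟨ +-cong (T-pascalˡ N e d (suc L) (+ suc L) (+ suc L) (λ ()) (e-3j L)) (Z≈ N L) ⟩
      (S N L + x * V N L) + (S N L + x * U N L)
        ≈⟨ solve 4 (λ s x v u → (s :+ x :* v) :+ (s :+ x :* u) := (s :+ s) :+ x :* (v :+ u)) refl (S N L) x (V N L) (U N L) ⟩
      (S N L + S N L) + x * W N L ∎
      where x = q ^ suc L

    -- Lowering the first index gives `Z` and a sum at `(L + 1, L + 1)` with exponent `d`; lowering
    -- the second index of the latter gives `V` and returns to `S`.
    S-suc : ∀ N L → S N (suc L) ≈ (S N L + q ^ suc L * W N L) + q ^ suc L * (q ^ suc L * S N L)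
    S-suc N L = begin
      S N (suc L)
        ≈⟨ T-pascalˡ N e d (suc L) (+ suc L) (+ suc (suc L)) (λ ()) (e-3j L) ⟩
      Z N L + x * T N d (+ suc L) (+ suc L)
        ≈⟨ +-cong (Z≈ N L) (*-congˡ (T-pascalʳ N d e (suc L) (+ suc L) (+ suc L) (λ ()) (d+3j L))) ⟩
      (S N L + x * U N L) + x * (V N L + x * S N L)
        ≈⟨ solve 4 (λ s x v u → (s :+ x :* u) :+ x :* (v :+ x :* s) := (s :+ x :* (v :+ u)) :+ x :* (x :* s)) refl (S N L) x (V N L) (U N L) ⟩
      (S N L + x * W N L) + x * (x * S N L) ∎
      where x = q ^ suc L

    -- A Pascal step on `V` leaves `C + U′` besides `x * X N L`. Completing `C` by `x * F` to a sum
    -- at `(L + 3, L)` makes it cancel `U′` under the shift, and `F` is itself the negative of `Z`.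
    W-suc : ∀ M L → L ℕ.< M → W (suc M) (suc L) ≈ q ^ suc L * ((S (suc M) L + S (suc M) L) + q ^ suc L * W (suc M) L)
    W-suc M L L<M = begin
      V N (suc L) + U′
        ≈⟨ +-congʳ (T-pascalʳ N d e (suc L) (+ suc (suc L)) (+ suc L) (λ ()) (d+3j L)) ⟩
      (C + x * X N L) + U′
        ≈⟨ +-identityʳ _ ⟨
      ((C + x * X N L) + U′) + 0#
        -- The added zero supplies `x * F` for `C` and `x * Z N L` for `X`.
        ≈⟨ +-congˡ (trans (*-congˡ F+Z≈0) (zeroʳ x)) ⟨
      ((C + x * X N L) + U′) + x * (F + Z N L)
        ≈⟨ solve 6 (λ c x y u f z → ((c :+ x :* y) :+ u) :+ x :* (f :+ z) := ((c :+ x :* f) :+ u) :+ x :* (y :+ z)) refl C x (X N L) U′ F (Z N L) ⟩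
      ((C + x * F) + U′) + x * (X N L + Z N L)
        ≈⟨ +-congʳ (+-congʳ (T-pascalˡ N d (e ∘ ℤ.pred) (suc L) (+ suc (suc (suc L))) (+ L) (λ ()) (d-3j L))) ⟨
      (T N d (+ suc (suc (suc L))) (+ L) + U′) + x * (X N L + Z N L)
        ≈⟨ +-cong (T-shift M d (d ∘ ℤ.suc) (+ suc (suc (suc L))) (+ L) (+ L) (+ suc (suc (suc L))) L+3≤ L≤ (λ _ → ≡.refl) (ℤ.+-comm (+ 3) (+ L)) (ℤ.+-comm (+ 3) (+ L))) (*-congˡ (X+Z N L)) ⟩
      0# + x * ((S N L + S N L) + x * W N L)
        ≈⟨ +-identityˡ _ ⟩
      x * ((S N L + S N L) + x * W N L) ∎
      where
      N = suc M
      x = q ^ suc L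
      C = T N d (+ suc (suc L)) (+ L)
      U′ = U N (suc L)
      F = T N (e ∘ ℤ.pred) (+ suc (suc (suc L))) (ℤ.pred (+ L))
      -- Both shifts start from the index `L + 3`, which is at most `M + 2` by `L < M`.
      L+3≤ : + suc (suc (suc L)) ℤ.≤ + (2 ℕ.+ 3 ℕ.* M)
      L+3≤ = ℤ.+≤+ (s≤s (s≤s (ℕ.≤-trans L<M (ℕ.m≤m+n M _))))
      L≤ : + L ℤ.≤ + (2 ℕ.+ 3 ℕ.* M)
      L≤ = ℤ.≤-trans (ℤ.+≤+ (ℕ.m≤n+m L 3)) L+3≤
      2+l : ∀ l → + 2 ℤ.+ l ≡ (ℤ.- + 1 ℤ.+ l) ℤ.+ + 3
      2+l = solve-∀
      F+Z≈0 : F + Z N L ≈ 0#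
      F+Z≈0 = T-shift M (e ∘ ℤ.pred) e (+ suc (suc (suc L))) (ℤ.pred (+ L)) (+ L) (+ suc (suc L)) L+3≤ (ℤ.i≤j⇒pred[i]≤j L≤)
        (λ j → ≡.cong e (≡.sym (ℤ.pred-suc j))) (ℤ.+-comm (+ 3) (+ L)) (2+l (+ L))

    -- Indices at most 2 become negative after a single step of three, so only `j = 0` survives.
    T-single : ∀ N ε a b → a ℤ.≤ + 2 → b ℤ.≤ + 2 → T N ε a b ≈ q ^ ε (+ 0) * Q a b
    T-single N ε a b a≤2 b≤2 = begin
      T N ε a b            ≈⟨ ∑±-single N (term ε a b) vanishes ⟩
      term ε a b (+ 0)     ≈⟨ *-cong (*-identityˡ _) (reflexive (≡.cong₂ Q (ℤ.+-identityʳ a) (ℤ.+-identityʳ b))) ⟩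
      q ^ ε (+ 0) * Q a b  ∎
      where
      vanishes : ∀ j → j ≢ + 0 → term ε a b j ≈ 0#
      vanishes j j≢0 = term-vanishes ε 0 j a≤2 b≤2 (ℕ.n≢0⇒n>0 (j≢0 ∘ ℤ.∣i∣≡0⇒i≡0))

    S-zero : ∀ N → S N 0 ≈ 1#
    S-zero N = trans (T-single N e (+ 0) (+ 1) (ℤ.+≤+ z≤n) (ℤ.+≤+ (s≤s z≤n))) (trans (*-identityˡ _) (Q-0ˡ 1))

    W-zero : ∀ N → W N 0 ≈ 1#
    W-zero N = begin
      V N 0 + U N 0
        ≈⟨ +-cong (T-single N d (+ 1) (+ 0) (ℤ.+≤+ (s≤s z≤n)) (ℤ.+≤+ z≤n))
                  (T-single N (d ∘ ℤ.suc) (ℤ.pred (+ 0)) (+ 2) ℤ.-≤+ (ℤ.+≤+ ℕ.≤-refl)) ⟩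
      -- At `L = 0` the first index of `U` is `- 1`, so its only candidate term is zero; the
      -- exponent is `d 1 = 1`.
      1# * Q (+ 1) (+ 0) + q ^ 1 * 0#
        ≈⟨ +-cong (trans (*-identityˡ _) (trans (Q-comm (+ 1) (+ 0)) (Q-0ˡ 1))) (zeroʳ _) ⟩
      1# + 0#
        ≈⟨ +-identityʳ 1# ⟩
      1# ∎

    -- The left-hand side as a polynomial

    -- The truncated `L ∸ k` does no harm beyond `k = L`, since the q-binomial factor vanishes
    -- there.
    w : ℕ → ℕ → Carrier
    w L k = pochhammer (- q) q (L ℕ.∸ k) * qBinomial (+ L) (+ k)

    -- With `L = k + n` both subtractions disappear; the coefficient identities are proved in this
    -- form first.
    w-+ : ∀ k n → w (k ℕ.+ n) k ≈ pochhammer (- q) q n * Q (+ k) (+ n)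
    w-+ k n = *-cong (reflexive (≡.cong (pochhammer (- q) q) (ℕ.m+n∸m≡n k n)))
                     (reflexive (≡.cong (Q (+ k)) (k+n-k (+ k) (+ n))))
      where
      k+n-k : ∀ i j → (i ℤ.+ j) ℤ.- i ≡ j
      k+n-k = solve-∀

    w-large : ∀ {L k} → L ℕ.< k → w L k ≈ 0#
    w-large {L} {k} L<k = trans (*-congˡ (Q-negʳ {a = + k} L-k<0)) (zeroʳ _)
      where
      L-k<0 : + L ℤ.- + k ℤ.< + 0
      L-k<0 = ≡.subst (+ L ℤ.- + k ℤ.<_) (ℤ.+-inverseʳ (+ k)) (ℤ.+-monoˡ-< (ℤ.- + k) (ℤ.+<+ L<k))

    pochhammer-suc : ∀ n → pochhammer (- q) q (suc n) ≈ pochhammer (- q) q n * (1# + q ^ suc n)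
    pochhammer-suc n = *-congˡ (+-congˡ (begin
      - (- q * q ^ n)  ≈⟨ -‿cong (-‿distribˡ-* q (q ^ n)) ⟨
      - - (q * q ^ n)  ≈⟨ RingProperties.-‿involutive ring _ ⟩
      q * q ^ n        ∎))

    w-zero : ∀ L → w (suc L) 0 ≈ (1# + q ^ suc L) * w L 0
    w-zero L = begin
      w (suc L) 0                                               ≈⟨ w-+ 0 (suc L) ⟩
      pochhammer (- q) q (suc L) * Q (+ 0) (+ suc L)            ≈⟨ *-cong (pochhammer-suc L) (trans (Q-0ˡ (suc L)) (sym (Q-0ˡ L))) ⟩
      pochhammer (- q) q L * (1# + q ^ suc L) * Q (+ 0) (+ L)   ≈⟨ solve 3 (λ g t x → g :* t :* x := t :* (g :* x)) refl _ _ _ ⟩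
      (1# + q ^ suc L) * (pochhammer (- q) q L * Q (+ 0) (+ L)) ≈⟨ *-congˡ (w-+ 0 L) ⟨
      (1# + q ^ suc L) * w L 0                                  ∎

    -- In the second Pascal term the Pochhammer symbol has one factor more than in `w L (suc k)`,
    -- where `L = k + n`. That factor is `1 + q^(L-k)`, and multiplied by `q^(k+1)` it gives
    -- `q^(k+1) + q^(L+1)`.
    w-pascal-+ : ∀ k n → w (suc k ℕ.+ n) (suc k) ≈
                 w (k ℕ.+ n) k + (q ^ suc k + q ^ suc (k ℕ.+ n)) * w (k ℕ.+ n) (suc k)
    -- Here `k = L`: there is no factor to split off, and `w L (suc L)` vanishes instead.
    w-pascal-+ k zero = begin
      w (suc k ℕ.+ 0) (suc k)                     ≈⟨ w-+ (suc k) 0 ⟩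
      1# * Q (+ suc k) (+ 0)                      ≈⟨ *-congˡ (Q-pascalˡ (+ suc k) (+ 0) (λ ())) ⟩
      1# * (Q (+ k) (+ 0) + q ^ suc k * 0#)       ≈⟨ *-congˡ (trans (+-congˡ (zeroʳ _)) (+-identityʳ _)) ⟩
      1# * Q (+ k) (+ 0)                          ≈⟨ w-+ k 0 ⟨
      w (k ℕ.+ 0) k                               ≈⟨ +-identityʳ _ ⟨
      w (k ℕ.+ 0) k + 0#                          ≈⟨ +-congˡ (trans (*-congˡ (w-large (ℕ.≤-reflexive (≡.cong suc (ℕ.+-identityʳ k))))) (zeroʳ _)) ⟨
      w (k ℕ.+ 0) k + (q ^ suc k + q ^ suc (k ℕ.+ 0)) * w (k ℕ.+ 0) (suc k) ∎
    w-pascal-+ k (suc n) = begin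
      w (suc k ℕ.+ suc n) (suc k)
        ≈⟨ w-+ (suc k) (suc n) ⟩
      g′ * Q (+ suc k) (+ suc n)
        ≈⟨ *-congˡ (Q-pascal-suc k n) ⟩
      g′ * (q₁ + x * q₂)
        ≈⟨ distribˡ g′ q₁ (x * q₂) ⟩
      g′ * q₁ + g′ * (x * q₂)
        ≈⟨ +-congˡ (*-congʳ (pochhammer-suc n)) ⟩
      g′ * q₁ + g * (1# + y) * (x * q₂)
        ≈⟨ +-congˡ (solve 4 (λ g y x q₂ → g :* (con 1 :+ y) :* (x :* q₂) := (x :+ x :* y) :* (g :* q₂)) refl g y x q₂) ⟩
      g′ * q₁ + (x + x * y) * (g * q₂)
        ≈⟨ +-cong (w-+ k (suc n)) (*-cong (+-congˡ (^-homo-* q (suc k) (suc n)))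
                  (trans (reflexive (≡.cong (λ L → w L (suc k)) (ℕ.+-suc k n))) (w-+ (suc k) n))) ⟨
      w (k ℕ.+ suc n) k + (x + q ^ suc (k ℕ.+ suc n)) * w (k ℕ.+ suc n) (suc k) ∎
      where
      g  = pochhammer (- q) q n
      g′ = pochhammer (- q) q (suc n)
      q₁ = Q (+ k) (+ suc n)
      q₂ = Q (+ suc k) (+ n)
      x  = q ^ suc k
      y  = q ^ suc n

    -- The absorption rule `(1 - q^(k+1)) Q (k+1) n = (1 - q^(k+n+1)) Q k n` without subtraction. It
    -- compares the two Pascal expansions of `Q (k+1) n`.
    Q-absorb : ∀ k n → q ^ suc k * Q (+ suc k) (+ n) + Q (+ k) (+ n) ≈
               Q (+ suc k) (+ n) + q ^ suc (k ℕ.+ n) * Q (+ k) (+ n)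
    Q-absorb k n = begin
      x * Q (+ suc k) (+ n) + q₀
        ≈⟨ +-congʳ (*-congˡ (Q-pascalʳ (+ suc k) (+ n) (λ ()))) ⟩
      x * (q₁ + y * q₀) + q₀
        ≈⟨ solve 4 (λ x y q₁ q₀ → x :* (q₁ :+ y :* q₀) :+ q₀ := (q₀ :+ x :* q₁) :+ x :* y :* q₀) refl x y q₁ q₀ ⟩
      (q₀ + x * q₁) + x * y * q₀
        ≈⟨ +-cong (Q-pascalˡ (+ suc k) (+ n) (λ ())) (*-congʳ (^-homo-* q (suc k) n)) ⟨
      Q (+ suc k) (+ n) + q ^ suc (k ℕ.+ n) * q₀ ∎
      where
      x  = q ^ suc k
      y  = q ^ n
      q₀ = Q (+ k) (+ n)
      q₁ = Q (+ suc k) (ℤ.pred (+ n))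

    w-absorb-+ : ∀ k n → q ^ suc k * w (suc k ℕ.+ n) (suc k) + w (k ℕ.+ n) k ≈
                 w (suc k ℕ.+ n) (suc k) + q ^ suc (k ℕ.+ n) * w (k ℕ.+ n) k
    w-absorb-+ k n = begin
      x * w (suc k ℕ.+ n) (suc k) + w (k ℕ.+ n) k
        ≈⟨ +-cong (*-congˡ (w-+ (suc k) n)) (w-+ k n) ⟩
      x * (g * q₁) + g * q₀
        ≈⟨ solve 4 (λ x g q₁ q₀ → x :* (g :* q₁) :+ g :* q₀ := g :* (x :* q₁ :+ q₀)) refl x g q₁ q₀ ⟩
      g * (x * q₁ + q₀)
        ≈⟨ *-congˡ (Q-absorb k n) ⟩
      g * (q₁ + y * q₀)
        ≈⟨ solve 4 (λ y g q₁ q₀ → g :* (q₁ :+ y :* q₀) := g :* q₁ :+ y :* (g :* q₀)) refl y g q₁ q₀ ⟩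
      g * q₁ + y * (g * q₀)
        ≈⟨ +-cong (w-+ (suc k) n) (*-congˡ (w-+ k n)) ⟨
      w (suc k ℕ.+ n) (suc k) + y * w (k ℕ.+ n) k ∎
      where
      g  = pochhammer (- q) q n
      q₀ = Q (+ k) (+ n)
      q₁ = Q (+ suc k) (+ n)
      x  = q ^ suc k
      y  = q ^ suc (k ℕ.+ n)

    w-pascal : ∀ {L k} → k ℕ.≤ L → w (suc L) (suc k) ≈ w L k + (q ^ suc k + q ^ suc L) * w L (suc k)
    w-pascal {L} {k} k≤L with n , ≡.refl ← ℕ.m≤n⇒∃[o]m+o≡n k≤L = w-pascal-+ k n

    w-absorb : ∀ {L k} → k ℕ.≤ L →
               q ^ suc k * w (suc L) (suc k) + w L k ≈ w (suc L) (suc k) + q ^ suc L * w L k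
    w-absorb {L} {k} k≤L with n , ≡.refl ← ℕ.m≤n⇒∃[o]m+o≡n k≤L = w-absorb-+ k n

    P : ℕ → Carrier → Carrier
    P L z = ∑₀≤ L (λ k → w L k * z ^ k)

    P-extend : ∀ L z → P L z ≈ ∑₀≤ (suc L) (λ k → w L k * z ^ k)
    P-extend L z = sym (begin
      ∑₀≤ (suc L) (λ k → w L k * z ^ k)  ≈⟨ ∑₀≤-last L (λ k → w L k * z ^ k) ⟩
      P L z + w L (suc L) * z ^ suc L    ≈⟨ +-congˡ (trans (*-congʳ (w-large {L} ℕ.≤-refl)) (zeroˡ _)) ⟩
      P L z + 0#                         ≈⟨ +-identityʳ _ ⟩
      P L z                              ∎)

    -- The three terms of `w-pascal` contribute `z * P L z`, `P L (q * z)` and `q ^ suc L * P L z`;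
    -- `w-zero` accounts for the constant coefficient.
    P-suc : ∀ L z → P (suc L) z ≈ (z + q ^ suc L) * P L z + P L (q * z)
    P-suc L z = begin
      w (suc L) 0 * 1# + ∑₀≤ L (λ k → w (suc L) (suc k) * z ^ suc k)
        ≈⟨ +-cong (trans (*-congʳ (w-zero L)) (*-congʳ (*-congʳ (+-comm 1# x))))
                  (trans (∑₀≤-cong L termwise) (∑₀≤-+ L (λ k → z * f k) (h ∘ suc))) ⟩
      (x + 1#) * w L 0 * 1# + (∑₀≤ L (λ k → z * f k) + ∑₀≤ L (h ∘ suc))
        ≈⟨ +-cong (solve 2 (λ x w → (x :+ con 1) :* w :* con 1 := x :* (w :* con 1) :+ w :* con 1) refl x (w L 0))
                  (+-congʳ (∑₀≤-*ˡ L z f)) ⟩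
      h 0 + (z * P L z + ∑₀≤ L (h ∘ suc))
        -- `h 0` is the missing first term of the sum of `h` up to `suc L`. Its last term is zero,
        -- which is what `P-extend` uses.
        ≈⟨ solve 3 (λ a b c → a :+ (b :+ c) := b :+ (a :+ c)) refl (h 0) (z * P L z) (∑₀≤ L (h ∘ suc)) ⟩
      z * P L z + ∑₀≤ (suc L) h
        ≈⟨ +-congˡ (∑₀≤-+ (suc L) (λ k → x * f k) f′) ⟩
      z * P L z + (∑₀≤ (suc L) (λ k → x * f k) + ∑₀≤ (suc L) f′)
        ≈⟨ +-congˡ (+-cong (trans (∑₀≤-*ˡ (suc L) x f) (*-congˡ (sym (P-extend L z)))) (sym (P-extend L (q * z)))) ⟩
      z * P L z + (x * P L z + P L (q * z))
        ≈⟨ solve 4 (λ z x p p′ → z :* p :+ (x :* p :+ p′) := (z :+ x) :* p :+ p′) refl z x (P L z) (P L (q * z)) ⟩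
      (z + x) * P L z + P L (q * z) ∎
      where
      x = q ^ suc L
      f f′ h : ℕ → Carrier
      f k  = w L k * z ^ k
      f′ k = w L k * (q * z) ^ k
      h k  = x * f k + f′ k
      termwise : ∀ k → k ℕ.≤ L → w (suc L) (suc k) * z ^ suc k ≈ z * f k + h (suc k)
      termwise k k≤L = begin
        w (suc L) (suc k) * z ^ suc k
          ≈⟨ *-congʳ (w-pascal k≤L) ⟩
        (w L k + (q ^ suc k + x) * w L (suc k)) * (z * z ^ k)
          ≈⟨ solve 6 (λ w₀ y x w₁ z zk → (w₀ :+ (y :+ x) :* w₁) :* (z :* zk)
               := z :* (w₀ :* zk) :+ (x :* (w₁ :* (z :* zk)) :+ w₁ :* (y :* (z :* zk)))) refl
               (w L k) (q ^ suc k) x (w L (suc k)) z (z ^ k) ⟩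
        z * f k + (x * f (suc k) + w L (suc k) * (q ^ suc k * z ^ suc k))
          ≈⟨ +-congˡ (+-congˡ (*-congˡ (^-distrib-* q z (suc k)))) ⟨
        z * f k + h (suc k) ∎

    -- This and what follows from it has no subtraction, so that the semiring
    -- solver suffices.
    P-shift : ∀ L z → P (suc L) (q * z) + z * P L z ≈ P (suc L) z + q ^ suc L * (z * P L z)
    P-shift L z = begin
      (w₀ + ∑₀≤ L F′) + z * P L z                        ≈⟨ +-assoc _ _ _ ⟩
      w₀ + (∑₀≤ L F′ + z * P L z)                        ≈⟨ +-congˡ (+-congˡ (∑₀≤-*ˡ L z f)) ⟨
      w₀ + (∑₀≤ L F′ + ∑₀≤ L (λ k → z * f k))            ≈⟨ +-congˡ (∑₀≤-+ L F′ (λ k → z * f k)) ⟨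
      -- The constant term is unaffected by `z ↦ q z`. In degree `k + 1` that substitution produces
      -- `q ^ suc k`, which `w-absorb` trades for `q ^ suc L` on the lower coefficient.
      w₀ + ∑₀≤ L (λ k → F′ k + z * f k)                  ≈⟨ +-congˡ (∑₀≤-cong L termwise) ⟩
      w₀ + ∑₀≤ L (λ k → F k + x * (z * f k))             ≈⟨ +-congˡ (∑₀≤-+ L F (λ k → x * (z * f k))) ⟩
      w₀ + (∑₀≤ L F + ∑₀≤ L (λ k → x * (z * f k)))       ≈⟨ +-congˡ (+-congˡ (trans (∑₀≤-*ˡ L x (λ k → z * f k)) (*-congˡ (∑₀≤-*ˡ L z f)))) ⟩
      w₀ + (∑₀≤ L F + x * (z * P L z))                   ≈⟨ +-assoc _ _ _ ⟨
      P (suc L) z + x * (z * P L z)                      ∎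
      where
      x = q ^ suc L
      w₀ = w (suc L) 0 * 1#
      f F F′ : ℕ → Carrier
      f k  = w L k * z ^ k
      F k  = w (suc L) (suc k) * z ^ suc k
      F′ k = w (suc L) (suc k) * (q * z) ^ suc k
      termwise : ∀ k → k ℕ.≤ L → F′ k + z * f k ≈ F k + x * (z * f k)
      termwise k k≤L = begin
        w₁ * (q * z) ^ suc k + z * (w L k * zk)
          ≈⟨ +-congʳ (*-congˡ (^-distrib-* q z (suc k))) ⟩
        w₁ * (y * (z * zk)) + z * (w L k * zk)
          ≈⟨ solve 5 (λ w₁ y z zk v → w₁ :* (y :* (z :* zk)) :+ z :* (v :* zk) := (y :* w₁ :+ v) :* (z :* zk)) refl w₁ y z zk (w L k) ⟩
        (y * w₁ + w L k) * (z * zk)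
          ≈⟨ *-congʳ (w-absorb k≤L) ⟩
        (w₁ + x * w L k) * (z * zk)
          ≈⟨ solve 5 (λ w₁ x z zk v → (w₁ :+ x :* v) :* (z :* zk) := w₁ :* (z :* zk) :+ x :* (z :* (v :* zk))) refl w₁ x z zk (w L k) ⟩
        F k + x * (z * f k) ∎
        where
        w₁ = w (suc L) (suc k)
        y = q ^ suc k
        zk = z ^ k

    -- Matching the recurrences of the two sides

    A B : ℕ → Carrier
    A L = P L (q ^ suc L)
    B L = P L (q ^ suc (suc L))

    -- `A (suc L)` is `P (suc L) (q * x)` with `x = q ^ suc L`, so `P-shift` and then `P-suc` apply
    -- at `z = x`; the common summand `x * A L` cancels.
    A-suc : ∀ L → A (suc L) ≈ (B L + q ^ suc L * A L) + q ^ suc L * (q ^ suc L * A L)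
    A-suc L = +-cancelʳ (x * A L) (A (suc L)) _ (begin
      A (suc L) + x * A L                             ≈⟨ P-shift L x ⟩
      P (suc L) x + x * (x * A L)                     ≈⟨ +-congʳ (P-suc L x) ⟩
      ((x + x) * A L + B L) + x * (x * A L)           ≈⟨ solve 3 (λ x a b → ((x :+ x) :* a :+ b) :+ x :* (x :* a) := ((b :+ x :* a) :+ x :* (x :* a)) :+ x :* a) refl x (A L) (B L) ⟩
      ((B L + x * A L) + x * (x * A L)) + x * A L     ∎)
      where
      x = q ^ suc L
      open RingProperties ring using (+-cancelʳ)

    B-suc : ∀ L → B (suc L) + q ^ suc (suc L) * B L ≈ A (suc L) + q ^ suc L * (q ^ suc (suc L) * B L)
    B-suc L = P-shift L (q ^ suc (suc L))

    P-zero : ∀ z → P 0 z ≈ 1#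
    P-zero z = trans (+-identityʳ _) (trans (*-identityʳ _) (trans (*-identityˡ _) (Q-0ˡ 0)))

    -- The window `suc M` stays fixed while `L` grows up to `M`, so the hypothesis for `suc L` is
    -- the strict bound that `W-suc` asks for.
    A≈S×B+xS≈S+xW : ∀ L M → L ℕ.≤ M →
      A L ≈ S (suc M) L × B L + q ^ suc L * S (suc M) L ≈ S (suc M) L + q ^ suc L * W (suc M) L
    A≈S×B+xS≈S+xW zero M _ =
      trans (P-zero (q ^ 1)) (sym (S-zero N)) ,
      +-cong (trans (P-zero (q ^ 2)) (sym (S-zero N))) (*-congˡ (trans (S-zero N) (sym (W-zero N))))
      where N = suc M
    A≈S×B+xS≈S+xW (suc L) M L<M with A≈S×B+xS≈S+xW L M (ℕ.<⇒≤ L<M)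
    ... | A≈S , B+xS≈S+xW = A′≈S′ , (begin
      B (suc L) + y * S N (suc L)
        -- Writing the new `S` through `B L` produces the summand `y * B L` that `B-suc` needs on
        -- its left.
        ≈⟨ +-congˡ (*-congˡ S′≈) ⟩
      B (suc L) + y * ((B L + x * s) + x * (x * s))
        ≈⟨ solve 5 (λ b′ y b x s → b′ :+ y :* ((b :+ x :* s) :+ x :* (x :* s)) := (b′ :+ y :* b) :+ y :* (x :* s :+ x :* (x :* s))) refl (B (suc L)) y (B L) x s ⟩
      (B (suc L) + y * B L) + y * (x * s + x * (x * s))
        ≈⟨ +-congʳ (trans (B-suc L) (+-congʳ A′≈S′)) ⟩
      (S N (suc L) + x * (y * B L)) + y * (x * s + x * (x * s))
        ≈⟨ solve 5 (λ s′ y b x s → (s′ :+ x :* (y :* b)) :+ y :* (x :* s :+ x :* (x :* s)) := s′ :+ y :* (x :* (s :+ (b :+ x :* s)))) refl (S N (suc L)) y (B L) x s ⟩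
      S N (suc L) + y * (x * (s + (B L + x * s)))
        ≈⟨ +-congˡ (*-congˡ (*-congˡ (trans (+-congˡ B+xS≈S+xW) (sym (+-assoc _ _ _))))) ⟩
      S N (suc L) + y * (x * ((s + s) + x * W N L))
        ≈⟨ +-congˡ (*-congˡ (W-suc M L L<M)) ⟨
      S N (suc L) + y * W N (suc L) ∎)
      where
      N = suc M
      x = q ^ suc L
      y = q ^ suc (suc L)
      s = S N L
      S′≈ : S N (suc L) ≈ (B L + x * s) + x * (x * s)
      S′≈ = trans (S-suc N L) (+-congʳ (sym B+xS≈S+xW))
      A′≈S′ : A (suc L) ≈ S N (suc L)
      A′≈S′ = trans (A-suc L) (trans (+-cong (+-congˡ (*-congˡ A≈S)) (*-congˡ (*-congˡ A≈S))) (sym S′≈))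

    -- Translation to the summands of the theorem

    summand : ∀ L k → pochhammer (- q) q (L ℕ.∸ k) * q ^ ((L ℕ.+ 1) ℕ.* k) * qBinomial (+ L) (+ k) ≈
              w L k * (q ^ suc L) ^ k
    summand L k = begin
      g * q ^ ((L ℕ.+ 1) ℕ.* k) * b  ≈⟨ *-congʳ (*-congˡ (reflexive (≡.cong (λ n → q ^ (n ℕ.* k)) (ℕ.+-comm L 1)))) ⟩
      g * q ^ (suc L ℕ.* k) * b      ≈⟨ *-congʳ (*-congˡ (^-assocʳ q (suc L) k)) ⟨
      g * (q ^ suc L) ^ k * b        ≈⟨ solve 3 (λ g x b → g :* x :* b := g :* b :* x) refl g ((q ^ suc L) ^ k) b ⟩
      w L k * (q ^ suc L) ^ k        ∎
      where
      g = pochhammer (- q) q (L ℕ.∸ k)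
      b = qBinomial (+ L) (+ k)

    qBinomial≡Q : ∀ L j → qBinomial (+ (2 ℕ.* L ℕ.+ 1)) (+ L ℤ.- + 3 ℤ.* j) ≡ Q (+ L ℤ.- + 3 ℤ.* j) (+ suc L ℤ.+ + 3 ℤ.* j)
    qBinomial≡Q L j = ≡.cong (Q (+ L ℤ.- + 3 ℤ.* j)) (complement (+ L) (+ 3 ℤ.* j))
      where
      complement : ∀ l t → (l ℤ.+ (l ℤ.+ + 0) ℤ.+ + 1) ℤ.- (l ℤ.- t) ≡ (+ 1 ℤ.+ l) ℤ.+ t
      complement = solve-∀

mainTheorem4 :
  ∀ {c ℓ} (R : CommutativeRing c ℓ) →
  let open CommutativeRing R
      open RingNotation R in
  (q : Carrier) (1-qⁿ-unit : ∀ n → IsUnit (1# - q ^ suc n)) →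
  let open QBinomial q 1-qⁿ-unit in
  (L : ℕ) →
  -- The exponent 3j² + j is nonnegative for every integer j, so ∣_∣ only
  -- turns it into a natural number.
  (∑₀≤ L λ k →
    pochhammer (- q) q (L ℕ.∸ k) * q ^ ((L ℕ.+ 1) ℕ.* k) * qBinomial (+ L) (+ k))
  IsSumOverℤ
  (λ j →
    (- 1#) ^ ∣ j ∣ * q ^ ∣ + 3 ℤ.* j ℤ.* j ℤ.+ j ∣
      * qBinomial (+ (2 ℕ.* L ℕ.+ 1)) (+ L ℤ.- + 3 ℤ.* j))
-- The terms vanish already for `∣ j ∣ > L`; the bound `suc L` is the window of the induction with
-- `M = L`.
mainTheorem4 R q 1-qⁿ-unit L = suc L , vanishes , (begin
  ∑₀≤ L (λ k → pochhammer (- q) q (L ℕ.∸ k) * q ^ ((L ℕ.+ 1) ℕ.* k) * qBinomial (+ L) (+ k))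
    ≈⟨ ∑₀≤-cong L (λ k _ → summand q 1-qⁿ-unit L k) ⟩
  A q 1-qⁿ-unit L
    ≈⟨ proj₁ (A≈S×B+xS≈S+xW q 1-qⁿ-unit L L ℕ.≤-refl) ⟩
  S q 1-qⁿ-unit (suc L) L
    ≈⟨ ∑±-cong (suc L) (λ j → term≈ j) ⟨
  ∑± (suc L) rhs ∎)
  where
  open CommutativeRing R
  open RingNotation R
  open QBinomial q 1-qⁿ-unit
  open Sums R
  open QBinomialSums R
  open SetoidReasoning setoid
  rhs : ℤ → Carrier
  rhs j = (- 1#) ^ ∣ j ∣ * q ^ ∣ + 3 ℤ.* j ℤ.* j ℤ.+ j ∣
            * qBinomial (+ (2 ℕ.* L ℕ.+ 1)) (+ L ℤ.- + 3 ℤ.* j)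
  term≈ : ∀ j → rhs j ≈ term q 1-qⁿ-unit e (+ L) (+ suc L) j
  term≈ j = *-congˡ (reflexive (qBinomial≡Q q 1-qⁿ-unit L j))
  L+1≤ : + suc L ℤ.≤ + (2 ℕ.+ 3 ℕ.* L)
  L+1≤ = ℤ.+≤+ (s≤s (ℕ.m≤n⇒m≤1+n (ℕ.m≤m+n L _)))
  vanishes : ∀ j → suc L ℕ.< ∣ j ∣ → rhs j ≈ 0#
  vanishes j L<j = trans (term≈ j)
    (term-vanishes q 1-qⁿ-unit e L j (ℤ.≤-trans (ℤ.+≤+ (ℕ.n≤1+n L)) L+1≤) L+1≤ (ℕ.<⇒≤ L<j))
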